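{- For any stable set $\Pi$ of forward-looking tree-profiles, the spi-logic $\mathsf{SPi}+\Sigma'_\Pi$, where $\Sigma'_\Pi=\{\iota'_\pi\mid\pi\in\Pi\}$, is complete.
   Context: Fix a non-empty signature $\mathcal R$. Sp-formulas: built from propositional variables and $\top$ with $\wedge$ and diamonds $\Diamond_R$ ($R\in\mathcal R$); sp-implications $\sigma\to\tau$. A SLO is an algebra $(A,\wedge,\top,\Diamond_R)_R$ with $(A,\wedge,\top)$ a meet-semilattice with top $\top$ and each $\Diamond_R$ monotone; it validates $\sigma\to\tau$ if $\sigma[\mathfrak a]\le\tau[\mathfrak a]$ for all valuations. Frames $\mathfrak F=(W,R^{\mathfrak F})_R$ with standard Kripke semantics. $\Sigma\models_{\mathsf{Kr}}\iota$ (resp. $\models_{\mathsf{SLO}}$): $\iota$ valid in all frames (resp. SLOs) validating $\Sigma$. The spi-logic $\mathsf{SPi}+\Sigma=\{\iota\mid\Sigma\models_{\mathsf{SLO}}\iota\}$ is complete if $\Sigma\models_{\mathsf{Kr}}\iota\iff\Sigma\models_{\mathsf{SLO}}\iota$ for all $\iota$. A homomorphism $h:\mathfrak F_1\to\mathfrak F_2$ of frames is a map with $(x,y)\in R^{\mathfrak F_1}\Rightarrow(h(x),h(y))\in R^{\mathfrak F_2}$ for all $R$. A frame is a tree if $(W,\bigcup_RR^{\mathfrak F})$ is a finite directed tree and the relations are pairwise disjoint. A profile $\pi=(\mathfrak G,S,u,v)$ consists of a finite rooted frame $\mathfrak G=(\Delta,R^{\mathfrak G})_R$, $u,v\in\Delta$,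 $S\in\mathcal R$ with $(u,v)\notin S^{\mathfrak G}$; it represents $\Phi_\pi=\forall\bar x\big(\bigwedge_{(x_i,x_j)\in R^{\mathfrak G}}R(x_i,x_j)\to S(u,v)\big)$ (universal closure over $\Delta$). It is a tree-profile if $\mathfrak G$ is a tree, and forward-looking if $u<_{\mathfrak G}v$, where $<_{\mathfrak G}$ is the transitive closure of $\bigcup_R R^{\mathfrak G}$. For a set $\Pi$ of profiles and a frame $\mathfrak F$, $\Pi(\mathfrak F)$ is the smallest frame on the same domain extending $\mathfrak F$ (relation-wise) that satisfies $\Phi_\pi$ for all $\pi\in\Pi$. $\Pi$ is stable if for every $\pi=(\mathfrak G,S,u,v)\in\Pi$ and every tree $\mathfrak T$, every homomorphism $\mathfrak G\to\Pi(\mathfrak T)$ is also a homomorphism $\mathfrak G\to\mathfrak T$. For a model $\mathfrak N=(\mathfrak F,\mathfrak v)$ over a finite frame with root $r$ and no directed cycles, where only finitely many variables are non-empty, define inductively $\mathrm{for}^{\mathfrak N}_w=\bigwedge_{w\in\mathfrak v(p)}p\wedge\bigwedge_{(w,v)\in R^{\mathfrak F},R\in\mathcal R}\Diamond_R\,\mathrm{for}^{\mathfrak N}_v$ (empty conjunction $=\top$) and $\mathrm{for}(\mathfrak N)=\mathrm{for}^{\mathfrak N}_r$. For a forward-looking tree-profile $\pi=(\mathfrak G,S,u,v)$ take a variable $p_x$ for each $x\in\Delta$, the valuation $\mathfrak v(p_x)=\{x\}$, $\mathfrak M=(\mathfrak G,\mathfrak v)$ and $\mathfrak M'=(\mathfrak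 G',\mathfrak v)$ where $\mathfrak G'$ equals $\mathfrak G$ except $S^{\mathfrak G'}=S^{\mathfrak G}\cup\{(u,v)\}$; then $\iota'_\pi=\big(\mathrm{for}(\mathfrak M)\to\mathrm{for}(\mathfrak M')\big)$. -}

module Defs where

open import Level using (Level; 0ℓ; _⊔_) renaming (suc to lsuc)
open import Data.Fin using (Fin; toℕ)
open import Data.Fin.Properties using (_≟_)
open import Data.Fin.Induction using (spo-noetherian)
open import Data.List using (List; []; _∷_; [_]; map; filter; foldr; concat; allFin)
open import Data.List.Membership.Propositional using (_∈_; mapWith∈)
open import Data.List.Relation.Unary.Any using (here; there)
open import Data.Nat using (ℕ)
open import Data.Product using (Σ; Σ-syntax; ∃-syntax; _×_; _,_; proj₁; proj₂)
open import Data.Unit using () renaming (⊤ to Unit)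
open import Function using (flip; _∘_)
open import Function.Bundles using (_⇔_)
open import Induction.WellFounded using (Acc; acc; WellFounded)
open import Relation.Binary.Construct.Closure.ReflexiveTransitive as Star using (Star; ε; _◅_)
open import Relation.Binary.Construct.Closure.Transitive as Plus using (TransClosure; _∷_; _++_)
open import Relation.Binary.Lattice.Bundles using (BoundedMeetSemilattice)
open import Relation.Binary.PropositionalEquality using (_≡_; refl; isEquivalence; resp₂)
open import Relation.Binary.Structures using (IsStrictPartialOrder)
open import Relation.Nullary using (¬_; yes; no)
open import Relation.Unary using (Pred)

infixr 7 _∧_
infix  5 _⇒_

-- The propositional variables are the natural numbers.
data Sp (𝓡 : Set) : Set where
  var : ℕ → Sp 𝓡
  ⊤   : Sp 𝓡
  _∧_ : Sp 𝓡 → Sp 𝓡 → Sp 𝓡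
  ◇   : 𝓡 → Sp 𝓡 → Sp 𝓡

⋀ : {𝓡 : Set} → List (Sp 𝓡) → Sp 𝓡
⋀ = foldr _∧_ ⊤

record SpImplication (𝓡 : Set) : Set where
  constructor _⇒_
  field
    premise    : Sp 𝓡
    conclusion : Sp 𝓡

record SLO (𝓡 : Set) (c ℓ₁ ℓ₂ : Level) : Set (lsuc (c ⊔ ℓ₁ ⊔ ℓ₂)) where
  field
    semilattice : BoundedMeetSemilattice c ℓ₁ ℓ₂

  open BoundedMeetSemilattice semilattice public
    renaming (_∧_ to _⊓_; ⊤ to 𝟙)

  field
    ⟨_⟩    : 𝓡 → Carrier → Carrier
    ⟨⟩-mono : ∀ R {a b} → a ≤ b → ⟨ R ⟩ a ≤ ⟨ R ⟩ b

  ⟦_⟧ : Sp 𝓡 → (ℕ → Carrier) → Carrier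
  ⟦ var p ⟧ 𝔞 = 𝔞 p
  ⟦ ⊤ ⟧     𝔞 = 𝟙
  ⟦ φ ∧ ψ ⟧ 𝔞 = ⟦ φ ⟧ 𝔞 ⊓ ⟦ ψ ⟧ 𝔞
  ⟦ ◇ R φ ⟧ 𝔞 = ⟨ R ⟩ (⟦ φ ⟧ 𝔞)

module _ {𝓡 : Set} {c ℓ₁ ℓ₂ : Level} where

  _⊨ˢ_ : SLO 𝓡 c ℓ₁ ℓ₂ → SpImplication 𝓡 → Set (c ⊔ ℓ₂)
  𝔄 ⊨ˢ (σ ⇒ τ) = ∀ 𝔞 → ⟦ σ ⟧ 𝔞 ≤ ⟦ τ ⟧ 𝔞
    where open SLO 𝔄

record Frame (𝓡 : Set) : Set₁ where
  field
    W   : Set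
    Rel : 𝓡 → W → W → Set

open Frame public

module _ {𝓡 : Set} where

  Valuation : Frame 𝓡 → Set₁
  Valuation 𝔉 = ℕ → Pred (W 𝔉) 0ℓ

  _∣_∣_⊩_ : (𝔉 : Frame 𝓡) → Valuation 𝔉 → W 𝔉 → Sp 𝓡 → Set
  𝔉 ∣ 𝔳 ∣ w ⊩ var p   = 𝔳 p w
  𝔉 ∣ 𝔳 ∣ w ⊩ ⊤       = Unit
  𝔉 ∣ 𝔳 ∣ w ⊩ (φ ∧ ψ) = (𝔉 ∣ 𝔳 ∣ w ⊩ φ) × (𝔉 ∣ 𝔳 ∣ w ⊩ ψ)
  𝔉 ∣ 𝔳 ∣ w ⊩ ◇ R φ   = Σ[ y ∈ W 𝔉 ] (Rel 𝔉 R w y × (𝔉 ∣ 𝔳 ∣ y ⊩ φ))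

  _⊨ᵏ_ : Frame 𝓡 → SpImplication 𝓡 → Set₁
  𝔉 ⊨ᵏ (σ ⇒ τ) = ∀ 𝔳 w → 𝔉 ∣ 𝔳 ∣ w ⊩ σ → 𝔉 ∣ 𝔳 ∣ w ⊩ τ

-- Frames are small.  The carriers of SLOs live one universe higher, so
-- that the full complex algebra of a frame (on all predicates
-- W 𝔉 → Set) is among the SLOs; small SLOs are covered by lifting.

module _ {𝓡 : Set} where

  _⊨Kr_ : Pred (SpImplication 𝓡) 0ℓ → SpImplication 𝓡 → Set₁
  Γ ⊨Kr ι = (𝔉 : Frame 𝓡) → (∀ {κ} → Γ κ → 𝔉 ⊨ᵏ κ) → 𝔉 ⊨ᵏ ι

  _⊨SLO_ : Pred (SpImplication 𝓡) 0ℓ → SpImplication 𝓡 → Set₂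
  Γ ⊨SLO ι = (𝔄 : SLO 𝓡 (lsuc 0ℓ) 0ℓ 0ℓ) → (∀ {κ} → Γ κ → 𝔄 ⊨ˢ κ) → 𝔄 ⊨ˢ ι

  SPi+ : Pred (SpImplication 𝓡) 0ℓ → Pred (SpImplication 𝓡) (lsuc (lsuc 0ℓ))
  SPi+ Γ ι = Γ ⊨SLO ι

  Complete : Pred (SpImplication 𝓡) 0ℓ → Set₂
  Complete Γ = ∀ ι → (Γ ⊨Kr ι) ⇔ SPi+ Γ ι

module _ {𝓡 : Set} where

  IsHom : (𝔉₁ 𝔉₂ : Frame 𝓡) → (W 𝔉₁ → W 𝔉₂) → Set
  IsHom 𝔉₁ 𝔉₂ h = ∀ {R x y} → Rel 𝔉₁ R x y → Rel 𝔉₂ R (h x) (h y)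

  Step : (𝔉 : Frame 𝓡) → W 𝔉 → W 𝔉 → Set
  Step 𝔉 x y = ∃[ R ] Rel 𝔉 R x y

  Before : (𝔉 : Frame 𝓡) → W 𝔉 → W 𝔉 → Set
  Before 𝔉 = TransClosure (Step 𝔉)

  IsRoot : (𝔉 : Frame 𝓡) → W 𝔉 → Set
  IsRoot 𝔉 r = ∀ x → Star (Step 𝔉) r x

  Acyclic : Frame 𝓡 → Set
  Acyclic 𝔉 = ∀ x → ¬ Before 𝔉 x x

-- A finite frame is presented up to isomorphism, with domain Fin size
-- and its finitely many edges listed; (R , x , y) ∈ edges means
-- (x , y) ∈ R.  Order and repetitions in the list are immaterial.

record FiniteRootedFrame (𝓡 : Set) : Set where
  field
    size  : ℕ
    edges : List (𝓡 × Fin size × Fin size)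

  frame : Frame 𝓡
  frame = record { W = Fin size ; Rel = λ R x y → (R , x , y) ∈ edges }

  field
    root   : Fin size
    isRoot : IsRoot frame root

open FiniteRootedFrame public

module _ {𝓡 : Set} where

  -- Reachability of every point from the root is isRoot 𝔊.
  record IsTree (𝔊 : FiniteRootedFrame 𝓡) : Set where
    field
      root-initial : ∀ {x} → ¬ Step (frame 𝔊) x (root 𝔊)
      unique-pred  : ∀ {x x′ y} → Step (frame 𝔊) x y → Step (frame 𝔊) x′ y → x ≡ x′
      disjoint     : ∀ {R R′ x y} → Rel (frame 𝔊) R x y → Rel (frame 𝔊) R′ x y → R ≡ R′

  private
    split-last : ∀ {𝔉 : Frame 𝓡} {x z} → Before 𝔉 x z →
                 ∃[ y ] (Star (Step 𝔉) x y × Step 𝔉 y z)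
    split-last Plus.[ s ] = _ , ε , s
    split-last (s ∷ p)    = let y , q , t = split-last p in y , s ◅ q , t

    _∷*_ : ∀ {𝔉 : Frame 𝓡} {x y z} → Step 𝔉 x y → Star (Step 𝔉) y z → Before 𝔉 x z
    s ∷* ε       = Plus.[ s ]
    s ∷* (t ◅ p) = s ∷ (t ∷* p)

  tree-acyclic : ∀ {𝔊 : FiniteRootedFrame 𝓡} → IsTree 𝔊 → Acyclic (frame 𝔊)
  tree-acyclic {𝔊} tree x = go (isRoot 𝔊 x) no-root-cycle
    where
    open IsTree tree

    no-root-cycle : ¬ Before (frame 𝔊) (root 𝔊) (root 𝔊)
    no-root-cycle c = root-initial (proj₂ (proj₂ (split-last c)))

    back : ∀ {y z} → Step (frame 𝔊) y z → Before (frame 𝔊) z z → Before (frame 𝔊) y y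
    back s c with split-last c
    ... | y′ , p , t with unique-pred s t
    ... | refl = s ∷* p

    go : ∀ {y z} → Star (Step (frame 𝔊)) y z →
         ¬ Before (frame 𝔊) y y → ¬ Before (frame 𝔊) z z
    go ε       ¬c = ¬c
    go (s ◅ p) ¬c = go p (¬c ∘ back s)

  acyclic-noetherian : (𝔊 : FiniteRootedFrame 𝓡) → Acyclic (frame 𝔊) →
                       WellFounded (flip (Before (frame 𝔊)))
  acyclic-noetherian 𝔊 acyclic = spo-noetherian isSPO
    where
    isSPO : IsStrictPartialOrder _≡_ (Before (frame 𝔊))
    isSPO = record
      { isEquivalence = isEquivalence
      ; irrefl        = λ { refl → acyclic _ }
      ; trans         = _++_
      ; <-resp-≈      = resp₂ (Before (frame 𝔊))
      }

module _ {𝓡 : Set} (𝔊 : FiniteRootedFrame 𝓡) where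

  -- A valuation in which only finitely many variables are non-empty,
  -- given by its graph: (p , w) ∈ 𝔳 means that p is true at w.
  FiniteValuation : Set
  FiniteValuation = List (ℕ × Fin (size 𝔊))

  outgoing : (w : Fin (size 𝔊)) → List (Σ[ (R , y) ∈ 𝓡 × Fin (size 𝔊) ] Rel (frame 𝔊) R w y)
  outgoing w = concat (mapWith∈ (edges 𝔊) from-w)
    where
    from-w : ∀ {e} → e ∈ edges 𝔊 → List (Σ[ (R , y) ∈ 𝓡 × Fin (size 𝔊) ] Rel (frame 𝔊) R w y)
    from-w {R , x , y} e∈ with x ≟ w
    ... | yes refl = [ (R , y) , e∈ ]
    ... | no  _    = []

  forAt : FiniteValuation → ∀ w → Acc (flip (Before (frame 𝔊))) w → Sp 𝓡
  forAt 𝔳 w (acc below) =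
      ⋀ (map (var ∘ proj₁) (filter (λ (_ , x) → x ≟ w) 𝔳))
    ∧ ⋀ (map (λ ((R , y) , e) → ◇ R (forAt 𝔳 y (below Plus.[ R , e ]))) (outgoing w))

  for : FiniteValuation → Acyclic (frame 𝔊) → Sp 𝓡
  for 𝔳 acyclic = forAt 𝔳 (root 𝔊) (acyclic-noetherian 𝔊 acyclic (root 𝔊))

record Profile (𝓡 : Set) : Set where
  field
    𝔊   : FiniteRootedFrame 𝓡
    S   : 𝓡
    u v : Fin (size 𝔊)
    u≁v : ¬ Rel (frame 𝔊) S u v

open Profile public

module _ {𝓡 : Set} where

  _⊨Φ_ : Frame 𝓡 → Profile 𝓡 → Set
  𝔉 ⊨Φ π = ∀ (x : W (frame (𝔊 π)) → W 𝔉) → IsHom (frame (𝔊 π)) 𝔉 x → Rel 𝔉 (S π) (x (u π)) (x (v π))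

  TreeProfile : Profile 𝓡 → Set
  TreeProfile π = IsTree (𝔊 π)

  ForwardLooking : Profile 𝓡 → Set
  ForwardLooking π = Before (frame (𝔊 π)) (u π) (v π)

  data ClosureRel (Π : Pred (Profile 𝓡) 0ℓ) (𝔉 : Frame 𝓡) : 𝓡 → W 𝔉 → W 𝔉 → Set where
    base : ∀ {R x y} → Rel 𝔉 R x y → ClosureRel Π 𝔉 R x y
    fire : ∀ {π} → Π π → (h : W (frame (𝔊 π)) → W 𝔉) →
           (∀ {R x y} → Rel (frame (𝔊 π)) R x y → ClosureRel Π 𝔉 R (h x) (h y)) →
           ClosureRel Π 𝔉 (S π) (h (u π)) (h (v π))

  -- Π(𝔉); the three lemmas below say that it is the smallest frame on
  -- the domain of 𝔉 that extends 𝔉 and satisfies every Φ_π with π ∈ Π.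
  Closure : Pred (Profile 𝓡) 0ℓ → Frame 𝓡 → Frame 𝓡
  Closure Π 𝔉 = record { W = W 𝔉 ; Rel = ClosureRel Π 𝔉 }

  closure-extends : ∀ Π (𝔉 : Frame 𝓡) {R x y} → Rel 𝔉 R x y → Rel (Closure Π 𝔉) R x y
  closure-extends Π 𝔉 = base

  closure-satisfies : ∀ Π (𝔉 : Frame 𝓡) {π} → Π π → Closure Π 𝔉 ⊨Φ π
  closure-satisfies Π 𝔉 π∈Π h hom = fire π∈Π h hom

  closure-least : ∀ Π (𝔉 : Frame 𝓡) (Q : 𝓡 → W 𝔉 → W 𝔉 → Set) →
                  (∀ {R x y} → Rel 𝔉 R x y → Q R x y) →
                  (∀ {π} → Π π → record { W = W 𝔉 ; Rel = Q } ⊨Φ π) →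
                  ∀ {R x y} → Rel (Closure Π 𝔉) R x y → Q R x y
  closure-least Π 𝔉 Q ext sat (base e)         = ext e
  closure-least Π 𝔉 Q ext sat (fire π∈Π h hom) =
    sat π∈Π h (λ e → closure-least Π 𝔉 Q ext sat (hom e))

  Stable : Pred (Profile 𝓡) 0ℓ → Set
  Stable Π = ∀ π → Π π → (𝔗 : FiniteRootedFrame 𝓡) → IsTree 𝔗 →
             (h : W (frame (𝔊 π)) → W (frame 𝔗)) →
             IsHom (frame (𝔊 π)) (Closure Π (frame 𝔗)) h →
             IsHom (frame (𝔊 π)) (frame 𝔗) h

module _ {𝓡 : Set} (π : Profile 𝓡) where

  𝔊′ : FiniteRootedFrame 𝓡
  𝔊′ = record
    { size   = size (𝔊 π)
    ; edges  = (S π , u π , v π) ∷ edges (𝔊 π)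
    ; root   = root (𝔊 π)
    ; isRoot = λ x → Star.map (λ (R , e) → R , there e) (isRoot (𝔊 π) x)
    }

  𝔊′-acyclic : TreeProfile π → ForwardLooking π → Acyclic (frame 𝔊′)
  𝔊′-acyclic tree u<v x = tree-acyclic tree x ∘ shrink
    where
    shrink-step : ∀ {y z} → Step (frame 𝔊′) y z → Before (frame (𝔊 π)) y z
    shrink-step (_ , here refl) = u<v
    shrink-step (R , there e)   = Plus.[ R , e ]

    shrink : ∀ {y z} → Before (frame 𝔊′) y z → Before (frame (𝔊 π)) y z
    shrink Plus.[ s ] = shrink-step s
    shrink (s ∷ p)    = shrink-step s ++ shrink p

  -- The variable p_x is toℕ x.
  𝔳π : FiniteValuation (𝔊 π)
  𝔳π = map (λ x → toℕ x , x) (allFin (size (𝔊 π)))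

  ι′ : TreeProfile π → ForwardLooking π → SpImplication 𝓡
  ι′ tree u<v = for (𝔊 π) 𝔳π (tree-acyclic tree) ⇒ for 𝔊′ 𝔳π (𝔊′-acyclic tree u<v)

module _ {𝓡 : Set} where

  Σ′ : (Π : Pred (Profile 𝓡) 0ℓ) →
       (∀ π → Π π → TreeProfile π) → (∀ π → Π π → ForwardLooking π) →
       Pred (SpImplication 𝓡) 0ℓ
  Σ′ Π tree forward ι =
    ∃[ π ] Σ[ π∈Π ∈ Π π ] (ι ≡ ι′ π (tree π π∈Π) (forward π π∈Π))

{-# OPTIONS --safe #-}

-- Soundness is witnessed by the complex algebra of a frame.  For the
-- converse, let 𝔄 validate Σ′_Π and let 𝔞 be a valuation.  Grow a finite
-- tree 𝔗 from σ whose points carry elements b of 𝔄 with b x ≤ ⟨R⟩ (b y)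
-- along its edges ("coherent" labellings), with b root = ⟦σ⟧ and with σ
-- true at the root.  The frame Π(𝔗) satisfies every Φ_π, hence validates
-- Σ′_Π, so τ holds at its root.  Now read the proof of τ off in 𝔄: if φ
-- holds at x in Π(𝔗), then every coherent labelling can be lowered, without
-- lowering it at the root, to a coherent one with b x ≤ ⟦φ⟧.  At a diamond,
-- first lower the target y of the edge (x , y).  If that edge was added by π
-- along h : 𝔊 → Π(𝔗), then h maps 𝔊 to 𝔗 by stability; evaluating ι′_π at
-- p_w ↦ b (h w) gives new labels along the path from h root to h u = x, with
-- the last one below ⟨S⟩ (b y).

module Submission where

open import Level using (Level; 0ℓ) renaming (suc to lsuc)
open import Data.Empty using (⊥-elim)
open import Data.Fin using (Fin; zero; suc; toℕ; fromℕ<)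
open import Data.Fin.Properties using (_≟_; toℕ<n; fromℕ<-toℕ)
open import Data.List using (List; []; _∷_; map; concat; allFin)
open import Data.List.Membership.Propositional using (_∈_; mapWith∈; find; lose)
open import Data.List.Membership.Propositional.Properties using (∈-map⁺; ∈-map⁻; ∈-filter⁺; ∈-filter⁻; ∈-allFin; ∈-++⁺ˡ; ∈-++⁺ʳ)
open import Data.List.Relation.Unary.Any using (here; there; any?)
open import Data.Nat using (ℕ; _<?_)
open import Data.Product using (Σ; Σ-syntax; ∃-syntax; _×_; _,_; proj₁; proj₂)
open import Data.Unit using (tt) renaming (⊤ to Unit)
open import Function using (_∘_; id; flip)
open import Function.Bundles using (mk⇔)
open import Induction.WellFounded using (Acc; acc)
open import Relation.Binary.Construct.Closure.ReflexiveTransitive as Star using (Star; ε; _◅_; _◅◅_)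
open import Relation.Binary.Construct.Closure.Transitive as Plus using ()
open import Relation.Binary.PropositionalEquality as ≡ using (_≡_; _≢_; refl; cong; subst)
open import Relation.Nullary using (Dec; yes; no; contradiction)
open import Relation.Unary using (Pred)
open import Defs

-- Outgoing edges in finite frames.

∈-concat-mapWith∈⁺ : {A B : Set} {xs : List A} (f : ∀ {x} → x ∈ xs → List B) {x : A} (x∈ : x ∈ xs) {z : B} →
                     z ∈ f x∈ → z ∈ concat (mapWith∈ xs f)
∈-concat-mapWith∈⁺ f (here refl) z∈ = ∈-++⁺ˡ z∈
∈-concat-mapWith∈⁺ f (there x∈)  z∈ = ∈-++⁺ʳ (f (here refl)) (∈-concat-mapWith∈⁺ (f ∘ there) x∈ z∈)

module _ {𝓡 : Set} (𝔊 : FiniteRootedFrame 𝓡) where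

  ∈-outgoing : ∀ {R w y} (e : Rel (frame 𝔊) R w y) → ((R , y) , e) ∈ outgoing 𝔊 w
  -- `intro` is abstracted together with `w ≟ w` so that its premise, which mentions the local
  -- function of `outgoing`, reduces with the decision.
  ∈-outgoing {R} {w} {y} e with w ≟ w | intro
    where
    intro : _ → ((R , y) , e) ∈ outgoing 𝔊 w
    intro = ∈-concat-mapWith∈⁺ _ e
  ... | yes refl | intro′ = intro′ (here refl)
  ... | no  w≢w  | _      = contradiction refl w≢w

  -- Agrees with `𝔳π` by computation; stated for any finite frame, it serves both `𝔊 π` and `𝔊′ π`.
  pointVariables : FiniteValuation 𝔊
  pointVariables = map (λ x → toℕ x , x) (allFin (size 𝔊))

-- Values of the formulas for_w in a SLO.

module _ {𝓡 : Set} {c ℓ₁ ℓ₂ : Level} (𝔄 : SLO 𝓡 c ℓ₁ ℓ₂) where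

  open SLO 𝔄 using (Carrier; _≤_; ⟨_⟩; ⟨⟩-mono; ⟦_⟧; trans; x∧y≤x; x∧y≤y; ∧-greatest; maximum)

  ⋀-lower : ∀ {X : Set} (f : X → Sp 𝓡) 𝔟 {x xs} → x ∈ xs → ⟦ ⋀ (map f xs) ⟧ 𝔟 ≤ ⟦ f x ⟧ 𝔟
  ⋀-lower f 𝔟 (here refl) = x∧y≤x _ _
  ⋀-lower f 𝔟 (there x∈)  = trans (x∧y≤y _ _) (⋀-lower f 𝔟 x∈)

  ⋀-greatest : ∀ {X : Set} (f : X → Sp 𝓡) 𝔟 {a} xs → (∀ {x} → x ∈ xs → a ≤ ⟦ f x ⟧ 𝔟) →
               a ≤ ⟦ ⋀ (map f xs) ⟧ 𝔟
  ⋀-greatest f 𝔟 []       a≤ = maximum _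
  ⋀-greatest f 𝔟 (x ∷ xs) a≤ = ∧-greatest (a≤ (here refl)) (⋀-greatest f 𝔟 xs (a≤ ∘ there))

  Coherent : (𝔊 : FiniteRootedFrame 𝓡) → (Fin (size 𝔊) → Carrier) → Set ℓ₂
  Coherent 𝔊 b = ∀ {R x y} → Rel (frame 𝔊) R x y → b x ≤ ⟨ R ⟩ (b y)

  -- The values of the formulas for_w form the greatest coherent labelling
  -- lying below the values of the variables p_w.
  module _ (𝔊 : FiniteRootedFrame 𝓡) (𝔟 : ℕ → Carrier) where

    private
      Accessible = Acc (flip (Before (frame 𝔊)))

      ⟦forAt⟧ : ∀ w → Accessible w → Carrier
      ⟦forAt⟧ w a = ⟦ forAt 𝔊 (pointVariables 𝔊) w a ⟧ 𝔟

    forAt-var : ∀ w a → ⟦forAt⟧ w a ≤ 𝔟 (toℕ w)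
    forAt-var w (acc _) = trans (x∧y≤x _ _)
      (⋀-lower (var ∘ proj₁) 𝔟 (∈-filter⁺ (λ (_ , x) → x ≟ w) (∈-map⁺ _ (∈-allFin w)) refl))

    forAt-greatest : (g : Fin (size 𝔊) → Carrier) → (∀ w → g w ≤ 𝔟 (toℕ w)) → Coherent 𝔊 g →
                     ∀ w a → g w ≤ ⟦forAt⟧ w a
    forAt-greatest g g≤ coh w (acc below) = ∧-greatest
      (⋀-greatest (var ∘ proj₁) 𝔟 _ at-var)
      (⋀-greatest _ 𝔟 (outgoing 𝔊 w) λ { {(R , y) , e} _ →
        trans (coh e) (⟨⟩-mono R (forAt-greatest g g≤ coh y (below Plus.[ R , e ]))) })
      where
      at-var : ∀ {px} → px ∈ _ → g w ≤ 𝔟 (proj₁ px)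
      at-var px∈ with ∈-filter⁻ (λ (_ , x) → x ≟ w) {xs = pointVariables 𝔊} px∈
      ... | px∈𝔳 , refl with ∈-map⁻ _ px∈𝔳
      ... | _ , _ , refl = g≤ w

    -- `forAt` recurses on the accessibility proof, so the successor formula inside for_x and the
    -- one labelling `y` may be built from different proofs.
    forAt-irrelevant : ∀ w a a′ → ⟦forAt⟧ w a ≤ ⟦forAt⟧ w a′
    forAt-irrelevant w (acc below) (acc below′) = ∧-greatest (x∧y≤x _ _)
      (trans (x∧y≤y _ _) (⋀-greatest _ 𝔟 (outgoing 𝔊 w) λ { {(R , y) , e} e∈ →
        trans (⋀-lower _ 𝔟 e∈) (⟨⟩-mono R (forAt-irrelevant y (below Plus.[ R , e ]) (below′ Plus.[ R , e ]))) }))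

    forAt-coherent : (a : ∀ w → Accessible w) → Coherent 𝔊 (λ w → ⟦forAt⟧ w (a w))
    forAt-coherent a {R} {x} {y} e with a x
    ... | acc below = trans (x∧y≤y _ _)
      (trans (⋀-lower _ 𝔟 (∈-outgoing 𝔊 e)) (⟨⟩-mono R (forAt-irrelevant y (below Plus.[ R , e ]) (a y))))

-- Kripke semantics and complex algebras.

module _ {𝓡 : Set} where

  ⊩-hom : ∀ {𝔉₁ 𝔉₂ : Frame 𝓡} {𝔳₁ 𝔳₂} (h : W 𝔉₁ → W 𝔉₂) → IsHom 𝔉₁ 𝔉₂ h →
          (∀ {p w} → 𝔳₁ p w → 𝔳₂ p (h w)) →
          ∀ φ {w} → 𝔉₁ ∣ 𝔳₁ ∣ w ⊩ φ → 𝔉₂ ∣ 𝔳₂ ∣ h w ⊩ φ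
  ⊩-hom h hom val (var p) s           = val s
  ⊩-hom h hom val ⊤       s           = tt
  ⊩-hom h hom val (φ ∧ ψ) (s , t)     = ⊩-hom h hom val φ s , ⊩-hom h hom val ψ t
  ⊩-hom h hom val (◇ R φ) (y , e , s) = h y , hom e , ⊩-hom h hom val φ s

  before-hom : ∀ {𝔉₁ 𝔉₂ : Frame 𝓡} {h} → IsHom 𝔉₁ 𝔉₂ h →
               ∀ {x y} → Before 𝔉₁ x y → Before 𝔉₂ (h x) (h y)
  before-hom hom Plus.[ R , e ] = Plus.[ R , hom e ]
  before-hom {𝔉₁} {𝔉₂} hom ((R , e) Plus.∷ p) = (R , hom e) Plus.∷ before-hom {𝔉₁} {𝔉₂} hom p

  complexAlgebra : Frame 𝓡 → SLO 𝓡 (lsuc 0ℓ) 0ℓ 0ℓ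
  complexAlgebra 𝔉 = record
    { semilattice = record
      { Carrier = Pred (W 𝔉) 0ℓ
      ; _≈_     = λ P Q → (∀ w → P w → Q w) × (∀ w → Q w → P w)
      ; _≤_     = λ P Q → ∀ w → P w → Q w
      ; _∧_     = λ P Q w → P w × Q w
      ; ⊤       = λ _ → Unit
      ; isBoundedMeetSemilattice = record
        { isMeetSemilattice = record
          { isPartialOrder = record
            { isPreorder = record
              { isEquivalence = record
                { refl  = (λ _ → id) , (λ _ → id)
                ; sym   = λ (f , g) → g , f
                ; trans = λ (f , g) (f′ , g′) → (λ w → f′ w ∘ f w) , (λ w → g w ∘ g′ w)
                }
              ; reflexive = proj₁
              ; trans     = λ f g w → g w ∘ f w
              }
            ; antisym = _,_
            }
          ; infimum = λ P Q → (λ _ → proj₁) , (λ _ → proj₂) , λ X f g w x → f w x , g w x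
          }
        ; maximum = λ _ _ _ → tt
        }
      }
    ; ⟨_⟩     = λ R P w → Σ[ y ∈ W 𝔉 ] (Rel 𝔉 R w y × P y)
    ; ⟨⟩-mono = λ R f w (y , e , s) → y , e , f y s
    }

  module _ (𝔉 : Frame 𝓡) (𝔳 : Valuation 𝔉) where

    open SLO (complexAlgebra 𝔉) using (⟦_⟧)

    ⊩⇒⟦⟧ : ∀ φ {w} → 𝔉 ∣ 𝔳 ∣ w ⊩ φ → ⟦ φ ⟧ 𝔳 w
    ⊩⇒⟦⟧ (var p) s           = s
    ⊩⇒⟦⟧ ⊤       s           = s
    ⊩⇒⟦⟧ (φ ∧ ψ) (s , t)     = ⊩⇒⟦⟧ φ s , ⊩⇒⟦⟧ ψ t
    ⊩⇒⟦⟧ (◇ R φ) (y , e , s) = y , e , ⊩⇒⟦⟧ φ s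

    ⟦⟧⇒⊩ : ∀ φ {w} → ⟦ φ ⟧ 𝔳 w → 𝔉 ∣ 𝔳 ∣ w ⊩ φ
    ⟦⟧⇒⊩ (var p) s           = s
    ⟦⟧⇒⊩ ⊤       s           = s
    ⟦⟧⇒⊩ (φ ∧ ψ) (s , t)     = ⟦⟧⇒⊩ φ s , ⟦⟧⇒⊩ ψ t
    ⟦⟧⇒⊩ (◇ R φ) (y , e , s) = y , e , ⟦⟧⇒⊩ φ s

  complexAlgebra-sound : ∀ 𝔉 ι → 𝔉 ⊨ᵏ ι → complexAlgebra 𝔉 ⊨ˢ ι
  complexAlgebra-sound 𝔉 (σ ⇒ τ) valid 𝔳 w = ⊩⇒⟦⟧ 𝔉 𝔳 τ ∘ valid 𝔳 w ∘ ⟦⟧⇒⊩ 𝔉 𝔳 σ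

  complexAlgebra-complete : ∀ 𝔉 ι → complexAlgebra 𝔉 ⊨ˢ ι → 𝔉 ⊨ᵏ ι
  complexAlgebra-complete 𝔉 (σ ⇒ τ) valid 𝔳 w = ⟦⟧⇒⊩ 𝔉 𝔳 τ ∘ valid 𝔳 w ∘ ⊩⇒⟦⟧ 𝔉 𝔳 σ

  -- From truth of for_w to homomorphisms out of a tree.

  module TreeChoice {𝔊 : FiniteRootedFrame 𝓡} (tree : IsTree 𝔊) (𝔉 : Frame 𝓡)
                    (F : Fin (size 𝔊) → Pred (W 𝔉) 0ℓ) (coherent : Coherent (complexAlgebra 𝔉) 𝔊 F)
                    {z₀ : W 𝔉} (z₀∈ : F (root 𝔊) z₀) where

    open IsTree tree

    private
      Edge : 𝓡 → Fin (size 𝔊) → Fin (size 𝔊) → Set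
      Edge = Rel (frame 𝔊)

      Incoming : Fin (size 𝔊) → Set
      Incoming y = Σ[ (R , x) ∈ 𝓡 × Fin (size 𝔊) ] Edge R x y

    -- Equality on `𝓡` is not assumed decidable, so edges are searched by end point alone; the tree
    -- axioms recover source and relation.
    incoming? : ∀ y → Dec (Incoming y)
    incoming? y with any? (λ (_ , _ , y′) → y′ ≟ y) (edges 𝔊)
    ... | no ¬any  = no λ (_ , e) → ¬any (lose e refl)
    ... | yes some with find some
    ... | (R , x , _) , e , refl = yes ((R , x) , e)

    -- The list of edges may contain repetitions, so an edge has several
    -- membership proofs; they must all be given the same witness.
    canonical : ∀ {R x y} → Dec (Incoming y) → Edge R x y → Edge R x y
    canonical (no _) e = e
    canonical (yes (_ , e′)) e with unique-pred (_ , e′) (_ , e)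
    ... | refl with disjoint e′ e
    ... | refl = e′

    canonical-constant : ∀ {R x y} (d : Dec (Incoming y)) (e₁ e₂ : Edge R x y) →
                         canonical d e₁ ≡ canonical d e₂
    canonical-constant (no ¬in) e₁ e₂ = contradiction (_ , e₁) ¬in
    canonical-constant (yes (_ , e′)) e₁ e₂
      with unique-pred (_ , e′) (_ , e₁) | unique-pred (_ , e′) (_ , e₂)
    ... | refl | refl with disjoint e′ e₁ | disjoint e′ e₂
    ... | refl | refl = refl

    data Path : Fin (size 𝔊) → Set where
      start : Path (root 𝔊)
      _▻_   : ∀ {R x y} → Path x → Edge R x y → Path y

    extend : ∀ {x y} → Path x → Star (Step (frame 𝔊)) x y → Path y
    extend p ε             = p
    extend p ((_ , e) ◅ s) = extend (p ▻ e) s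

    path : ∀ x → Path x
    path x = extend start (isRoot 𝔊 x)

    point : ∀ {x} → Path x → Σ (W 𝔉) (F x)
    point start = z₀ , z₀∈
    point (_▻_ {y = y} p e) =
      let z , z∈ = point p
          z′ , _ , z′∈ = coherent (canonical (incoming? y) e) z z∈
      in z′ , z′∈

    -- In a tree the end of a path determines its last edge up to the membership proof, which
    -- `point` sees only through `canonical`. This makes `choice` a homomorphism: an edge from `x`
    -- to `y` extends `path x` to a path that may differ from `path y`.
    point-unique : ∀ {x} (p q : Path x) → point p ≡ point q
    point-unique start   start   = refl
    point-unique start   (q ▻ e) = ⊥-elim (root-initial (_ , e))
    point-unique (p ▻ e) start   = ⊥-elim (root-initial (_ , e))
    point-unique (_▻_ {y = y} p e) (q ▻ e′) with unique-pred (_ , e) (_ , e′)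
    ... | refl with disjoint e e′
    ... | refl rewrite point-unique p q | canonical-constant (incoming? y) e e′ = refl

    choice : Fin (size 𝔊) → W 𝔉
    choice x = proj₁ (point (path x))

    choice-∈ : ∀ x → F x (choice x)
    choice-∈ x = proj₂ (point (path x))

    choice-root : choice (root 𝔊) ≡ z₀
    choice-root = cong proj₁ (point-unique (path (root 𝔊)) start)

    choice-hom : IsHom (frame 𝔊) 𝔉 choice
    choice-hom {R} {x} {y} e =
      subst (Rel 𝔉 R (choice x)) (cong proj₁ (point-unique (path x ▻ e) (path y)))
        (proj₁ (proj₂ (coherent (canonical (incoming? y) e) _ (choice-∈ x))))

  -- If the premise holds at `w`, its truth sets yield a homomorphism `choice` sending the root to
  -- `w`, and Φ_π supplies the additional edge. So the singletons of the chosen points form a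
  -- coherent labelling of `𝔊′ π`, and `forAt-greatest` gives the conclusion at `w`.
  Φ⇒ι′ : ∀ 𝔉 π (tree : TreeProfile π) (u<v : ForwardLooking π) → 𝔉 ⊨Φ π → 𝔉 ⊨ᵏ ι′ π tree u<v
  Φ⇒ι′ 𝔉 π tree u<v sat = complexAlgebra-complete 𝔉 (ι′ π tree u<v) λ 𝔳 w w⊩ →
    let open TreeChoice tree 𝔉 _ (forAt-coherent 𝔸 (𝔊 π) 𝔳 accessible) w⊩
        singleton-var = λ { x _ refl → forAt-var 𝔸 (𝔊 π) 𝔳 x (accessible x) _ (choice-∈ x) }
        singleton-coherent : Coherent 𝔸 (𝔊′ π) (λ x z → z ≡ choice x)
        singleton-coherent = λ
          { (here refl) _ refl → _ , sat choice choice-hom , refl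
          ; (there e)   _ refl → _ , choice-hom e , refl }
    in forAt-greatest 𝔸 (𝔊′ π) 𝔳 (λ x z → z ≡ choice x) singleton-var singleton-coherent
         (root (𝔊 π)) (accessible′ (root (𝔊 π))) w (≡.sym choice-root)
    where
    𝔸           = complexAlgebra 𝔉
    accessible  = acyclic-noetherian (𝔊 π) (tree-acyclic tree)
    accessible′ = acyclic-noetherian (𝔊′ π) (𝔊′-acyclic π tree u<v)

-- Lowering coherent labellings of a tree.

module _ {𝓡 : Set} {c ℓ₁ : Level} (𝔄 : SLO 𝓡 c ℓ₁ 0ℓ) where

  open SLO 𝔄 using (Carrier; _≤_; ⟨_⟩; ⟨⟩-mono; ⟦_⟧; 𝟙; trans; x∧y≤x; x∧y≤y; ∧-greatest; maximum)
    renaming (refl to ≤-refl)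

  ≡⇒≤ : ∀ {a b} → a ≡ b → a ≤ b
  ≡⇒≤ refl = ≤-refl

  module _ {n : ℕ} (g : Fin n → Carrier) where

    -- The value `𝟙` is a default: only variables below `n` occur in the formulas evaluated here.
    extendByTop : ℕ → Carrier
    extendByTop p with p <? n
    ... | yes p<n = g (fromℕ< p<n)
    ... | no _    = 𝟙

    extendByTop-toℕ : ∀ w → extendByTop (toℕ w) ≡ g w
    extendByTop-toℕ w with toℕ w <? n
    ... | yes p<n = cong g (fromℕ<-toℕ w p<n)
    ... | no p≮n  = contradiction (toℕ<n w) p≮n

  module Lowering {𝔗 : FiniteRootedFrame 𝓡} (tree : IsTree 𝔗) where

    open IsTree tree

    private
      Labelling : Set c
      Labelling = Fin (size 𝔗) → Carrier

    record Lowered (b : Labelling) (x : Fin (size 𝔗)) (a : Carrier) : Set c where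
      field
        label    : Labelling
        coherent : Coherent 𝔄 𝔗 label
        lower    : ∀ y → label y ≤ b y
        at-root  : b (root 𝔗) ≤ label (root 𝔗)
        at-point : label x ≤ a

    lowered-trans : ∀ {b x a x′ a′} (L : Lowered b x a) → Lowered (Lowered.label L) x′ a′ → Lowered b x′ a′
    lowered-trans L L′ = record
      { label    = L′.label
      ; coherent = L′.coherent
      ; lower    = λ y → trans (L′.lower y) (L.lower y)
      ; at-root  = trans L.at-root L′.at-root
      ; at-point = L′.at-point
      }
      where module L = Lowered L
            module L′ = Lowered L′

    lowered-self : ∀ {b x a} → Coherent 𝔄 𝔗 b → b x ≤ a → Lowered b x a
    lowered-self {b} coh b≤ = record
      { label = b ; coherent = coh ; lower = λ _ → ≤-refl ; at-root = ≤-refl ; at-point = b≤ }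

    lowered-weaken : ∀ {b x a a′} → a ≤ a′ → Lowered b x a → Lowered b x a′
    lowered-weaken a≤ L = record { Lowered L ; at-point = trans (Lowered.at-point L) a≤ }

    _[_≔_] : Labelling → Fin (size 𝔗) → Carrier → Labelling
    (b [ y ≔ a ]) z with z ≟ y
    ... | yes _ = a
    ... | no  _ = b z

    update-same : ∀ b y a → (b [ y ≔ a ]) y ≡ a
    update-same b y a with y ≟ y
    ... | yes _  = refl
    ... | no y≢y = contradiction refl y≢y

    update-other : ∀ b y a {z} → z ≢ y → (b [ y ≔ a ]) z ≡ b z
    update-other b y a {z} z≢y with z ≟ y
    ... | yes z≡y = contradiction z≡y z≢y
    ... | no _    = refl

    update-lower : ∀ b y a → a ≤ b y → ∀ z → (b [ y ≔ a ]) z ≤ b z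
    update-lower b y a a≤ z with z ≟ y
    ... | yes refl = a≤
    ... | no _     = ≤-refl

    -- The edge from `x` is the only one into `y`, and `b x ≤ ⟨ R ⟩ a` takes care of it. On edges
    -- out of `y` the smaller side shrinks, and acyclicity excludes a loop.
    update-coherent : ∀ {b R x y a} → Coherent 𝔄 𝔗 b → Rel (frame 𝔗) R x y →
                      a ≤ b y → b x ≤ ⟨ R ⟩ a → Coherent 𝔄 𝔗 (b [ y ≔ a ])
    update-coherent {y = y} coh e a≤ ≤a {R′} {x′} {y′} e′ with x′ ≟ y | y′ ≟ y
    ... | yes refl | yes refl = ⊥-elim (tree-acyclic tree _ Plus.[ _ , e′ ])
    ... | yes refl | no _     = trans a≤ (coh e′)
    ... | no _     | no _     = coh e′
    ... | no _     | yes refl with unique-pred (_ , e) (_ , e′)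
    ... | refl with disjoint e e′
    ... | refl = ≤a

    -- Walking from `w` to `u`, each point `h y` is relabelled by `f y`; the new edge is coherent
    -- since `b (h w) ≤ f w ≤ ⟨ R ⟩ (f y)`. As `h` may identify points, `f ≤ b ∘ h` is required only
    -- strictly after `w`. It survives a step because points after `y` are sent strictly after
    -- `h y`, hence are not relabelled.
    lower-along : ∀ {𝔊 : FiniteRootedFrame 𝓡} (h : Fin (size 𝔊) → Fin (size 𝔗)) →
                  IsHom (frame 𝔊) (frame 𝔗) h →
                  (f : Fin (size 𝔊) → Carrier) → Coherent 𝔄 𝔊 f →
                  ∀ {w u} → Star (Step (frame 𝔊)) w u →
                  (b : Labelling) → Coherent 𝔄 𝔗 b → b (h w) ≤ f w →
                  (∀ {y} → Before (frame 𝔊) w y → f y ≤ b (h y)) →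
                  Lowered b (h u) (f u)
    lower-along h hom f f-coh ε b coh b≤f f≤b = lowered-self coh b≤f
    lower-along {𝔊} h hom f f-coh {w} (_◅_ {j = y} (R , e) p) b coh b≤f f≤b =
      lowered-trans first (lower-along {𝔊} h hom f f-coh p _ (Lowered.coherent first)
        (Lowered.at-point first) f≤first)
      where
      first : Lowered b (h y) (f y)
      first = record
        { label    = b [ h y ≔ f y ]
        ; coherent = update-coherent coh (hom e) (f≤b Plus.[ R , e ]) (trans b≤f (f-coh e))
        ; lower    = update-lower b (h y) (f y) (f≤b Plus.[ R , e ])
        ; at-root  = ≡⇒≤ (≡.sym (update-other b (h y) (f y)
                       λ root≡ → root-initial (R , subst (Rel (frame 𝔗) R (h w)) (≡.sym root≡) (hom e))))
        ; at-point = ≡⇒≤ (update-same b (h y) (f y))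
        }

      f≤first : ∀ {z} → Before (frame 𝔊) y z → f z ≤ (b [ h y ≔ f y ]) (h z)
      f≤first {z} y<z = trans (f≤b ((R , e) Plus.∷ y<z)) (≡⇒≤ (≡.sym (update-other b (h y) (f y)
        λ hz≡hy → tree-acyclic tree (h y) (subst (Before (frame 𝔗) (h y)) hz≡hy
          (before-hom hom y<z)))))

    lower-fire : ∀ π (tr : TreeProfile π) (u<v : ForwardLooking π) → 𝔄 ⊨ˢ ι′ π tr u<v →
                 (h : Fin (size (𝔊 π)) → Fin (size 𝔗)) → IsHom (frame (𝔊 π)) (frame 𝔗) h →
                 ∀ {b} → Coherent 𝔄 𝔗 b → Lowered b (h (u π)) (⟨ S π ⟩ (b (h (v π))))
    lower-fire π tr u<v valid h hom {b} coh =
      -- `here refl` is the edge added in `𝔊′ π`. The walk itself uses only edges of `𝔊 π`, which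
      -- `h` preserves.
      lowered-weaken (trans (f-coh (here refl)) (⟨⟩-mono (S π) (f≤b (v π))))
        (lower-along {𝔊 π} h hom f (f-coh ∘ there) (isRoot (𝔊 π) (u π)) b coh b≤f (λ {y} _ → f≤b y))
      where
      𝔟 = extendByTop (b ∘ h)
      accessible = acyclic-noetherian (𝔊′ π) (𝔊′-acyclic π tr u<v)

      f : Fin (size (𝔊 π)) → Carrier
      f w = ⟦ forAt (𝔊′ π) (𝔳π π) w (accessible w) ⟧ 𝔟

      f-coh : Coherent 𝔄 (𝔊′ π) f
      f-coh = forAt-coherent 𝔄 (𝔊′ π) 𝔟 accessible

      f≤b : ∀ w → f w ≤ b (h w)
      f≤b w = trans (forAt-var 𝔄 (𝔊′ π) 𝔟 w (accessible w)) (≡⇒≤ (extendByTop-toℕ (b ∘ h) w))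

      -- Validity of ι′_π enters here: `b ∘ h` is coherent on `𝔊 π`, so at the root it lies below
      -- the premise, and the conclusion has the value `f (root (𝔊 π))`.
      b≤f : b (h (root (𝔊 π))) ≤ f (root (𝔊 π))
      b≤f = trans (forAt-greatest 𝔄 (𝔊 π) 𝔟 (b ∘ h) (λ w → ≡⇒≤ (≡.sym (extendByTop-toℕ (b ∘ h) w)))
              (coh ∘ hom) (root (𝔊 π)) (acyclic-noetherian (𝔊 π) (tree-acyclic tr) (root (𝔊 π)))) (valid 𝔟)

  -- Growing a labelled tree that realises a formula.

  module _ (𝔞 : ℕ → Carrier) where

    record LabelledTree : Set c where
      field
        𝔗        : FiniteRootedFrame 𝓡
        isTree   : IsTree 𝔗
        label    : Fin (size 𝔗) → Carrier
        coherent : Coherent 𝔄 𝔗 label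

      -- The order of `𝔄` is valued in `Set`, as a valuation on a small frame must be.
      valuation : Valuation (frame 𝔗)
      valuation p w = label w ≤ 𝔞 p

    open LabelledTree

    record Extension (M : LabelledTree) : Set c where
      field
        target    : LabelledTree
        embed     : Fin (size (𝔗 M)) → Fin (size (𝔗 target))
        hom       : IsHom (frame (𝔗 M)) (frame (𝔗 target)) embed
        same      : ∀ x → label target (embed x) ≡ label M x
        same-root : embed (root (𝔗 M)) ≡ root (𝔗 target)

    open Extension

    _⨟_ : ∀ {M} (E : Extension M) → Extension (target E) → Extension M
    E ⨟ E′ = record
      { target    = target E′
      ; embed     = embed E′ ∘ embed E
      ; hom       = hom E′ ∘ hom E
      ; same      = λ x → ≡.trans (same E′ _) (same E x)
      ; same-root = ≡.trans (cong (embed E′) (same-root E)) (same-root E′)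
      }

    identity : ∀ M → Extension M
    identity M = record { target = M ; embed = id ; hom = id ; same = λ _ → refl ; same-root = refl }

    embed-⊩ : ∀ {M} (E : Extension M) φ {x} → frame (𝔗 M) ∣ valuation M ∣ x ⊩ φ →
              frame (𝔗 (target E)) ∣ valuation (target E) ∣ embed E x ⊩ φ
    embed-⊩ E = ⊩-hom (embed E) (hom E) (λ {_} {w} → trans (≡⇒≤ (same E w)))

    singleton : Carrier → LabelledTree
    singleton a = record
      { 𝔗        = record { size = 1 ; edges = [] ; root = zero ; isRoot = λ { zero → ε } }
      ; isTree   = record
        { root-initial = λ { (_ , ()) }
        ; unique-pred  = λ { (_ , ()) }
        ; disjoint     = λ ()
        }
      ; label    = λ _ → a
      ; coherent = λ ()
      }

    module AddLeaf (M : LabelledTree) (x : Fin (size (𝔗 M))) (R : 𝓡) where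

      open IsTree (isTree M)

      private
        G : Frame 𝓡
        G = frame (𝔗 M)

        shift : 𝓡 × Fin (size (𝔗 M)) × Fin (size (𝔗 M)) →
                𝓡 × Fin (ℕ.suc (size (𝔗 M))) × Fin (ℕ.suc (size (𝔗 M)))
        shift (R′ , y , z) = R′ , suc y , suc z

      leafEdges : List (𝓡 × Fin (ℕ.suc (size (𝔗 M))) × Fin (ℕ.suc (size (𝔗 M))))
      leafEdges = (R , suc x , zero) ∷ map shift (edges (𝔗 M))

      -- Inverts membership in `leafEdges`, so that index unification discards impossible cases such
      -- as an old edge into the leaf `zero`.
      data LeafEdge : 𝓡 → Fin (ℕ.suc (size (𝔗 M))) → Fin (ℕ.suc (size (𝔗 M))) → Set where
        new : LeafEdge R (suc x) zero
        old : ∀ {R′ y z} → Rel G R′ y z → LeafEdge R′ (suc y) (suc z)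

      view : ∀ {R′ y z} → (R′ , y , z) ∈ leafEdges → LeafEdge R′ y z
      view (here refl) = new
      view (there e) with ∈-map⁻ shift e
      ... | _ , e′ , refl = old e′

      oldPath : ∀ {y z} → Star (Step G) y z →
                Star (λ y z → ∃[ R′ ] ((R′ , y , z) ∈ leafEdges)) (suc y) (suc z)
      oldPath = Star.gmap suc (λ (R′ , e) → R′ , there (∈-map⁺ shift e))

      leafFrame : FiniteRootedFrame 𝓡
      leafFrame = record
        { size   = ℕ.suc (size (𝔗 M))
        ; edges  = leafEdges
        ; root   = suc (root (𝔗 M))
        ; isRoot = λ
          { zero    → oldPath (isRoot (𝔗 M) x) ◅◅ ((R , here refl) ◅ ε)
          ; (suc y) → oldPath (isRoot (𝔗 M) y) }
        }

      leafFrame-isTree : IsTree leafFrame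
      leafFrame-isTree = record
        { root-initial = λ (_ , e) → initial (view e)
        ; unique-pred  = λ (_ , e) (_ , e′) → unique (view e) (view e′)
        ; disjoint     = λ e e′ → disj (view e) (view e′)
        }
        where
        initial : ∀ {R′ y} → LeafEdge R′ y (suc (root (𝔗 M))) → _
        initial (old e) = root-initial (_ , e)

        unique : ∀ {R₁ R₂ y₁ y₂ z} → LeafEdge R₁ y₁ z → LeafEdge R₂ y₂ z → y₁ ≡ y₂
        unique new     new      = refl
        unique (old e) (old e′) = cong suc (unique-pred (_ , e) (_ , e′))

        disj : ∀ {R₁ R₂ y z} → LeafEdge R₁ y z → LeafEdge R₂ y z → R₁ ≡ R₂
        disj new     new      = refl
        disj (old e) (old e′) = disjoint e e′

      addLeaf : ∀ a → label M x ≤ ⟨ R ⟩ a → Extension M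
      addLeaf a ≤a = record
        { target    = record
          { 𝔗 = leafFrame ; isTree = leafFrame-isTree ; label = label′ ; coherent = coh ∘ view }
        ; embed     = suc
        ; hom       = there ∘ ∈-map⁺ shift
        ; same      = λ _ → refl
        ; same-root = refl
        }
        where
        label′ : Fin (ℕ.suc (size (𝔗 M))) → Carrier
        label′ zero    = a
        label′ (suc y) = label M y

        coh : ∀ {R′ y z} → LeafEdge R′ y z → label′ y ≤ ⟨ R′ ⟩ (label′ z)
        coh new     = ≤a
        coh (old e) = coherent M e

    -- For a diamond the hypothesis is exactly coherence at a new leaf labelled `⟦ φ ⟧ 𝔞`. For a
    -- conjunction, truth of the first conjunct survives the second extension by `embed-⊩`.
    realise : ∀ φ M x → label M x ≤ ⟦ φ ⟧ 𝔞 →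
              Σ[ E ∈ Extension M ]
                (frame (𝔗 (target E)) ∣ valuation (target E) ∣ embed E x ⊩ φ)
    realise (var p) M x ≤φ = identity M , ≤φ
    realise ⊤       M x ≤φ = identity M , tt
    realise (φ ∧ ψ) M x ≤φ =
      let E  , s = realise φ M x (trans ≤φ (x∧y≤x _ _))
          E′ , t = realise ψ (target E) (embed E x)
                     (trans (≡⇒≤ (same E x)) (trans ≤φ (x∧y≤y _ _)))
      in E ⨟ E′ , embed-⊩ E′ φ s , t
    realise (◇ R φ) M x ≤φ =
      let E  = AddLeaf.addLeaf M x R (⟦ φ ⟧ 𝔞) ≤φ
          E′ , s = realise φ (target E) zero ≤-refl
      in E ⨟ E′ , embed E′ zero , hom E′ (here refl) , s

    -- Reading truth in Π(𝔗) off in the SLO.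

    module _ (Π : Pred (Profile 𝓡) 0ℓ)
             (tree : ∀ π → Π π → TreeProfile π) (forward : ∀ π → Π π → ForwardLooking π)
             (stable : Stable Π) (valid : ∀ {κ} → Σ′ Π tree forward κ → 𝔄 ⊨ˢ κ)
             (M : LabelledTree) where

      open Lowering (isTree M)

      -- The bound refers to the label of `y` before lowering; that suffices, since in the diamond
      -- case this label is already below `⟦ φ ⟧ 𝔞`.
      lower-edge : ∀ {R x y} → ClosureRel Π (frame (𝔗 M)) R x y →
                   ∀ {b} → Coherent 𝔄 (𝔗 M) b → Lowered b x (⟨ R ⟩ (b y))
      lower-edge (base e) coh = lowered-self coh (coh e)
      lower-edge (fire {π} π∈Π h hom) coh =
        lower-fire π (tree π π∈Π) (forward π π∈Π) (valid (π , π∈Π , refl)) h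
          -- Stability replaces recursion through `hom`: the premises of the rule are already edges
          -- of the tree.
          (stable π π∈Π (𝔗 M) (isTree M) h hom) coh

      -- The valuation stays fixed by `label M` while `b` descends; the bound by `label M` settles
      -- variables, and bounds once reached persist.
      lower-⊩ : ∀ φ {x b} → Closure Π (frame (𝔗 M)) ∣ valuation M ∣ x ⊩ φ →
                Coherent 𝔄 (𝔗 M) b → (∀ y → b y ≤ label M y) → Lowered b x (⟦ φ ⟧ 𝔞)
      lower-⊩ (var p) s coh b≤ = lowered-self coh (trans (b≤ _) s)
      lower-⊩ ⊤       s coh b≤ = lowered-self coh (maximum _)
      lower-⊩ (φ ∧ ψ) {x} (s , t) coh b≤ =
        let L  = lower-⊩ φ s coh b≤
            L′ = lower-⊩ ψ t (Lowered.coherent L) (λ y → trans (Lowered.lower L y) (b≤ y))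
            x≤φ∧ψ = ∧-greatest (trans (Lowered.lower L′ x) (Lowered.at-point L)) (Lowered.at-point L′)
        in lowered-trans L (record { Lowered L′ ; at-point = x≤φ∧ψ })
      lower-⊩ (◇ R φ) (y , e , s) coh b≤ =
        let L = lower-⊩ φ s coh b≤
        in lowered-trans L (lowered-weaken (⟨⟩-mono R (Lowered.at-point L))
             (lower-edge e (Lowered.coherent L)))

-- Soundness and completeness assembled.

theorem5p10 : (𝓡 : Set) → 𝓡 →
    (Π : Pred (Profile 𝓡) 0ℓ) →
    (tree : ∀ π → Π π → TreeProfile π) →
    (forward : ∀ π → Π π → ForwardLooking π) →
    Stable Π →
    Complete (Σ′ Π tree forward)
theorem5p10 𝓡 _ Π tree forward stable (σ ⇒ τ) = mk⇔ complete sound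
  where
  Γ = Σ′ Π tree forward

  sound : SPi+ Γ (σ ⇒ τ) → Γ ⊨Kr (σ ⇒ τ)
  sound Γ⊨ι 𝔉 𝔉⊨Γ = complexAlgebra-complete 𝔉 (σ ⇒ τ)
    (Γ⊨ι (complexAlgebra 𝔉) λ {κ} κ∈Γ → complexAlgebra-sound 𝔉 κ (𝔉⊨Γ κ∈Γ))

  closure-valid : ∀ 𝔉 {κ} → Γ κ → Closure Π 𝔉 ⊨ᵏ κ
  closure-valid 𝔉 (π , π∈Π , refl) =
    Φ⇒ι′ (Closure Π 𝔉) π (tree π π∈Π) (forward π π∈Π) (closure-satisfies Π 𝔉 π∈Π)

  complete : Γ ⊨Kr (σ ⇒ τ) → SPi+ Γ (σ ⇒ τ)
  complete Γ⊨ι 𝔄 𝔄⊨Γ 𝔞 = trans σ≤root (trans (Lowered.at-root L) (Lowered.at-point L))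
    where
    open SLO 𝔄 using (_≤_; ⟦_⟧; trans) renaming (refl to ≤-refl)

    start : LabelledTree 𝔄 𝔞
    start = singleton 𝔄 𝔞 (⟦ σ ⟧ 𝔞)

    E : Extension 𝔄 𝔞 start
    E = proj₁ (realise 𝔄 𝔞 σ start zero ≤-refl)

    open Extension E
    open LabelledTree target
    open Lowering 𝔄 isTree

    σ≤root : ⟦ σ ⟧ 𝔞 ≤ label (root 𝔗)
    σ≤root = ≡⇒≤ 𝔄 (≡.trans (≡.sym (same zero)) (cong label same-root))

    root⊩τ : Closure Π (frame 𝔗) ∣ valuation ∣ root 𝔗 ⊩ τ
    root⊩τ = Γ⊨ι (Closure Π (frame 𝔗)) (closure-valid (frame 𝔗)) valuation (root 𝔗)
      -- The identity is a homomorphism from 𝔗 to Π(𝔗), which carries σ over.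
      (⊩-hom id base id σ (subst (λ r → frame 𝔗 ∣ valuation ∣ r ⊩ σ) same-root
        (proj₂ (realise 𝔄 𝔞 σ start zero ≤-refl))))

    L : Lowered label (root 𝔗) (⟦ τ ⟧ 𝔞)
    L = lower-⊩ 𝔄 𝔞 Π tree forward stable 𝔄⊨Γ target τ root⊩τ coherent (λ _ → ≤-refl)
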